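{- Let $\mathcal{G}_1$ and $\mathcal{G}_2$ be two ADMGs on the same vertex set. Then $\mathcal{G}_1$ and $\mathcal{G}_2$ are Markov equivalent if and only if $\mathcal{S}(\mathcal{G}_1)=\mathcal{S}(\mathcal{G}_2)$.
   Context: An acyclic directed mixed graph (ADMG) $\mathcal{G}$ on a finite vertex set $\mathcal{V}$ has directed ($a\to b$) and bidirected ($a\leftrightarrow b$) edges and no directed cycle. $\mathrm{pa}_{\mathcal{G}}(v)=\{w:w\to v\}$, $\mathrm{an}_{\mathcal{G}}(v)$ ($\mathrm{de}_{\mathcal{G}}(v)$) is $v$ together with vertices having a directed path to (from) $v$, $\mathrm{dis}_{\mathcal{G}}(v)$ is $v$ together with vertices joined to $v$ by a path of bidirected edges; for sets take unions. For $W\subseteq\mathcal{V}$, $\mathcal{G}_W$ is the induced subgraph and $\mathrm{dis}_W(\cdot)$ the district in $\mathcal{G}_W$. A path is a sequence of distinct vertices, consecutive ones joined by an edge; a non-endpoint $w$ is a collider if both path edges at $w$ have an arrowhead at $w$ (each is $\to w$ or $\leftrightarrow w$), else a noncollider. For $a,b\notin C$, a path between $a,b$ is m-connecting given $C$ if all noncolliders are outside $C$ and all colliders are in $\mathrm{an}_{\mathcal{G}}(C)$; for disjoint $A,B,C$ with $A,B$ nonempty, $A,B$ are m-separated by $C$ if no such path joins any $a\in A$, $b\in B$. Two graphs on the same vertex set are Markov equivalent if exactly the same m-separations hold in both. $\mathrm{barren}_{\mathcal{G}}(W)=\{w\in W:\mathrm{de}_{\mathcal{G}}(w)\cap W=\{w\}\}$;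 a head is $H\subseteq\mathcal{V}$ with $\mathrm{barren}_{\mathcal{G}}(H)=H$ and $H$ contained in one district of $\mathcal{G}_{\mathrm{an}_{\mathcal{G}}(H)}$; $\mathrm{tail}(H)=(\mathrm{dis}_{\mathrm{an}_{\mathcal{G}}(H)}(H)\setminus H)\cup\mathrm{pa}_{\mathcal{G}}(\mathrm{dis}_{\mathrm{an}_{\mathcal{G}}(H)}(H))$; $\mathcal{S}(\mathcal{G})=\{H\cup A:H\text{ a head},\ A\subseteq\mathrm{tail}(H)\}$. -}

module Defs where

open import Data.Nat using (ℕ)
open import Data.Fin using (Fin)
open import Data.Fin.Subset using (Subset; _∈_; _∉_; _∪_; Nonempty)
open import Data.Bool using (Bool; true; false; if_then_else_; _∧_)
open import Data.Product using (Σ; ∃; _×_; _,_; proj₂)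
open import Data.List using (List; []; _∷_; map)
open import Data.List.Relation.Unary.Unique.Propositional using (Unique)
open import Data.Empty using (⊥)
open import Data.Unit using (⊤)
open import Relation.Nullary using (¬_)
open import Relation.Binary.PropositionalEquality using (_≡_)
open import Relation.Binary.Construct.Closure.ReflexiveTransitive using (Star)
open import Relation.Binary.Construct.Closure.Transitive using (TransClosure)
open import Function.Bundles using (_⇔_)

record ADMG (n : ℕ) : Set where
  field
    dir        : Fin n → Fin n → Bool          -- dir a b ≡ true  iff  a → b
    bid        : Fin n → Fin n → Bool
    bid-sym    : ∀ a b → bid a b ≡ bid b a
    bid-irrefl : ∀ a → bid a a ≡ false
    acyclic    : ∀ a → ¬ TransClosure (λ x y → dir x y ≡ true) a a

open ADMG public

module _ {n : ℕ} (G : ADMG n) where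

  DirE : Fin n → Fin n → Set
  DirE x y = dir G x y ≡ true

  IsAnc : Fin n → Fin n → Set
  IsAnc = Star DirE

  InAn : Subset n → Fin n → Set
  InAn W v = ∃ λ w → w ∈ W × IsAnc v w

  InPa : (Fin n → Set) → Fin n → Set
  InPa D v = ∃ λ d → D d × DirE v d

  BidIn : Subset n → Fin n → Fin n → Set
  BidIn H x y = bid G x y ≡ true × InAn H x × InAn H y

  InDisAnH : Subset n → Fin n → Set
  InDisAnH H v = ∃ λ h → h ∈ H × Star (BidIn H) h v

  IsBarrenSet : Subset n → Set
  IsBarrenSet H = ∀ h w → h ∈ H → w ∈ H → IsAnc h w → h ≡ w

  IsHead : Subset n → Set
  IsHead H = Nonempty H × IsBarrenSet H
           × (∀ h h′ → h ∈ H → h′ ∈ H → Star (BidIn H) h h′)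

  InTail : Subset n → Fin n → Set
  InTail H v = (InDisAnH H v × v ∉ H) Data.Sum.⊎ InPa (InDisAnH H) v
    where import Data.Sum

  InS : Subset n → Set
  InS X = ∃ λ H → ∃ λ A → IsHead H × (∀ v → v ∈ A → InTail H v) × X ≡ H ∪ A

  data Kind : Set where
    fwd bwd bi : Kind

  Edge : Kind → Fin n → Fin n → Set
  Edge fwd x y = dir G x y ≡ true
  Edge bwd x y = dir G y x ≡ true
  Edge bi  x y = bid G x y ≡ true

  headAtEnd : Kind → Bool
  headAtEnd fwd = true
  headAtEnd bwd = false
  headAtEnd bi  = true

  headAtStart : Kind → Bool
  headAtStart fwd = false
  headAtStart bwd = true
  headAtStart bi  = true

  -- a path is a start vertex plus a list of steps (edge kind, next vertex)
  Steps : Set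
  Steps = List (Kind × Fin n)

  vertices : Fin n → Steps → List (Fin n)
  vertices x s = x ∷ map proj₂ s

  lastV : Fin n → Steps → Fin n
  lastV x []            = x
  lastV x ((_ , y) ∷ s) = lastV y s

  ValidSteps : Fin n → Steps → Set
  ValidSteps x []            = ⊤
  ValidSteps x ((k , y) ∷ s) = Edge k x y × ValidSteps y s

  -- conditions at the interior vertices; y was entered via an edge of kind k
  InteriorOK : Subset n → Kind → Fin n → Steps → Set
  InteriorOK C k y []             = ⊤
  InteriorOK C k y ((k′ , z) ∷ s) =
    (if headAtEnd k ∧ headAtStart k′ then InAn C y else y ∉ C)
    × InteriorOK C k′ z s

  MConnOK : Subset n → Steps → Set
  MConnOK C []            = ⊤
  MConnOK C ((k , y) ∷ s) = InteriorOK C k y s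

  MConnecting : Subset n → Fin n → Fin n → Set
  MConnecting C a b = Σ Steps λ s →
    ValidSteps a s × Unique (vertices a s) × lastV a s ≡ b × MConnOK C s

  MSeparated : Subset n → Subset n → Subset n → Set
  MSeparated A B C = ∀ a b → a ∈ A → b ∈ B → ¬ MConnecting C a b

Disjoint : {n : ℕ} → Subset n → Subset n → Set
Disjoint A B = ∀ x → x ∈ A → x ∈ B → ⊥

MarkovEquivalent : {n : ℕ} → ADMG n → ADMG n → Set
MarkovEquivalent G₁ G₂ = ∀ A B C →
  Disjoint A B → Disjoint A C → Disjoint B C → Nonempty A → Nonempty B →
  (MSeparated G₁ A B C ⇔ MSeparated G₂ A B C)

SameS : {n : ℕ} → ADMG n → ADMG n → Set
SameS G₁ G₂ = ∀ X → (InS G₁ X ⇔ InS G₂ X)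

{-# OPTIONS --safe #-}
-- A nonempty set X is in S(G) iff all of X lies in, or is a parent of, a single district
-- of an(X); equivalently, no two vertices a, b of X are m-separated by any
-- C ⊇ X \ {a , b}.  The second description shows that Markov equivalence
-- determines S.  Conversely, let S(G₁) = S(G₂) and let a, b be m-connected
-- given C in G₁.  The path yields vertices a = x₀, …, x_k = b outside C and
-- sets Z_i ⊆ C with {x_i , x_{i+1}} ∪ Z_i ∈ S, each interior x_i being a strict
-- G₁-ancestor of a vertex of one of its two sets.  If some x_i is not in
-- A = an_{G₂}({a , b} ∪ C), take one of maximal G₂-rank: it is barren in G₂ in
-- the union of its two sets, so that this union is in S, and it is not barren
-- there in G₁, so that it can be removed from the union and from the sequence.
-- Once all x_i lie in A, consecutive ones are joined in G₂ by collider paths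
-- inside A, and these compose to an m-connecting path given C.

module Submission where

open import Defs
open import Data.Nat using (ℕ; zero; suc; _+_; _<_; _≤_; s≤s)
open import Data.Nat.Properties
  using (≤-trans; ≤-refl; n≮n; m<1+n⇒m<n∨m≡n; +-suc; m≤n⇒m≤1+n; +-identityʳ; m≤n+m; +-monoˡ-≤)
open import Data.Bool using (true; false; _∧_; if_then_else_)
import Data.Bool.Properties as Bool
open import Data.Fin using (Fin; _≟_)
open import Data.Fin.Properties using (any?)
open import Data.Fin.Subset using (Subset; _∈_; _∉_; _∪_; _⊆_; ⁅_⁆; ∣_∣; ⊥)
open import Data.Fin.Subset.Properties
  using (_∈?_; x∈⁅x⁆; x∈⁅y⁆⇒x≡y; x∈p∪q⁺; x∈p∪q⁻; ⊆-antisym; p⊂q⇒∣p∣<∣q∣; ∣p∣≤n; ∉⊥)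
open import Data.Vec using (tabulate)
open import Data.Vec.Properties using (lookup∘tabulate; []=⇒lookup; lookup⇒[]=)
open import Data.List using (List; []; _∷_; allFin)
import Data.List.Membership.Propositional as List
open import Data.List.Membership.Propositional.Properties using (∈-allFin)
open import Data.List.Membership.DecPropositional using () renaming (_∈?_ to memberOf?)
open import Data.List.Relation.Unary.Any using (here; there)
open import Data.List.Relation.Unary.All.Properties using (¬Any⇒All¬)
open import Data.List.Relation.Unary.AllPairs using ([]; _∷_)
open import Data.List.Relation.Unary.All using ([])
open import Data.List.Relation.Unary.Unique.Propositional using (Unique)
open import Data.Product using (∃; _×_; _,_; proj₁; proj₂)
open import Data.Sum using (_⊎_; inj₁; inj₂; [_,_]′)
open import Data.Empty using (⊥-elim) renaming (⊥ to Empty)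
open import Data.Unit using (⊤; tt)
open import Function using (_∘_)
open import Function.Bundles using (_⇔_; mk⇔; Equivalence)
open import Relation.Nullary using (¬_; Dec; yes; no; does; contradiction)
open import Relation.Nullary.Decidable
  using (map′; _×-dec_; _⊎-dec_; ¬?; decidable-stable; dec-true)
open import Relation.Binary.PropositionalEquality using (_≡_; refl; sym; trans; subst)
open import Relation.Binary.Construct.Closure.ReflexiveTransitive
  using (Star; ε; _◅_; _◅◅_; reverse) renaming (map to mapStar)
open import Relation.Binary.Construct.Closure.Transitive using (TransClosure; [_]; _∷_)

-- Deciding reachability in a finite relation

-- Warshall's algorithm: vs bounds the intermediate vertices.
module _ {n : ℕ} {R : Fin n → Fin n → Set} where

  Via : List (Fin n) → Fin n → Fin n → Set
  Via []       x y = x ≡ y ⊎ R x y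
  Via (v ∷ vs) x y = Via vs x y ⊎ (Via vs x v × Via vs v y)

  via-step : ∀ vs {x y} → x ≡ y ⊎ R x y → Via vs x y
  via-step []       r = r
  via-step (_ ∷ vs) r = inj₁ (via-step vs r)

  -- When both halves pass through the head of the list, the stretch between its first and last
  -- visit is dropped, so a single visit suffices.
  via-trans : ∀ {vs v x y} → v List.∈ vs → Via vs x v → Via vs v y → Via vs x y
  via-trans (here refl) p q = inj₂ ([ (λ r → r) , proj₁ ]′ p , [ (λ r → r) , proj₂ ]′ q)
  via-trans (there i) (inj₁ p)       (inj₁ q)       = inj₁ (via-trans i p q)
  via-trans (there i) (inj₁ p)       (inj₂ (q , r)) = inj₂ (via-trans i p q , r)
  via-trans (there i) (inj₂ (o , p)) (inj₁ q)       = inj₂ (o , via-trans i p q)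
  via-trans (there i) (inj₂ (o , _)) (inj₂ (_ , r)) = inj₂ (o , r)

  via-sound : ∀ vs {x y} → Via vs x y → Star R x y
  via-sound []       (inj₁ refl)    = ε
  via-sound []       (inj₂ r)       = r ◅ ε
  via-sound (v ∷ vs) (inj₁ p)       = via-sound vs p
  via-sound (v ∷ vs) (inj₂ (p , q)) = via-sound vs p ◅◅ via-sound vs q

  via-complete : ∀ {x y} → Star R x y → Via (allFin n) x y
  via-complete ε                = via-step (allFin n) (inj₁ refl)
  via-complete (_◅_ {j = z} r p) =
    via-trans (∈-allFin z) (via-step (allFin n) (inj₂ r)) (via-complete p)

  via? : (∀ x y → Dec (R x y)) → ∀ vs x y → Dec (Via vs x y)
  via? R? []       x y = (x ≟ y) ⊎-dec R? x y
  via? R? (v ∷ vs) x y = via? R? vs x y ⊎-dec (via? R? vs x v ×-dec via? R? vs v y)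

  star? : (∀ x y → Dec (R x y)) → ∀ x y → Dec (Star R x y)
  star? R? x y = map′ (via-sound (allFin n)) via-complete (via? R? (allFin n) x y)

-- Subsets by comprehension and sets of the form {x , y} ∪ Z

module _ {n : ℕ} {P : Fin n → Set} (P? : ∀ v → Dec (P v)) where

  comprehension : Subset n
  comprehension = tabulate (λ v → does (P? v))

  ∈-comprehension⁺ : ∀ {v} → P v → v ∈ comprehension
  ∈-comprehension⁺ {v} p =
    lookup⇒[]= v _ (trans (lookup∘tabulate _ v) (dec-true (P? v) p))

  ∈-comprehension⁻ : ∀ {v} → v ∈ comprehension → P v
  ∈-comprehension⁻ {v} i with P? v | trans (sym (lookup∘tabulate (λ u → does (P? u)) v)) ([]=⇒lookup i)
  ... | yes p | _ = p

module _ {n : ℕ} where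

  triple : Fin n → Fin n → Subset n → Subset n
  triple x y Z = ⁅ x ⁆ ∪ (⁅ y ⁆ ∪ Z)

  ∈-triple₁ : ∀ {x y} Z → x ∈ triple x y Z
  ∈-triple₁ {x} Z = x∈p∪q⁺ (inj₁ (x∈⁅x⁆ x))

  ∈-triple₂ : ∀ x {y} Z → y ∈ triple x y Z
  ∈-triple₂ x {y} Z = x∈p∪q⁺ (inj₂ (x∈p∪q⁺ (inj₁ (x∈⁅x⁆ y))))

  ∈-triple₃ : ∀ {x y Z v} → v ∈ Z → v ∈ triple x y Z
  ∈-triple₃ v∈Z = x∈p∪q⁺ (inj₂ (x∈p∪q⁺ (inj₂ v∈Z)))

  ∈-triple⁻ : ∀ {x y Z v} → v ∈ triple x y Z → v ≡ x ⊎ v ≡ y ⊎ v ∈ Z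
  ∈-triple⁻ {x} {y} {Z} i with x∈p∪q⁻ ⁅ x ⁆ _ i
  ... | inj₁ j = inj₁ (x∈⁅y⁆⇒x≡y x j)
  ... | inj₂ j with x∈p∪q⁻ ⁅ y ⁆ Z j
  ...   | inj₁ k = inj₂ (inj₁ (x∈⁅y⁆⇒x≡y y k))
  ...   | inj₂ k = inj₂ (inj₂ k)

  triple-elim : ∀ {x y Z} (P : Fin n → Set) → P x → P y → (∀ {v} → v ∈ Z → P v) →
                ∀ {v} → v ∈ triple x y Z → P v
  triple-elim P px py pz i with ∈-triple⁻ i
  ... | inj₁ refl        = px
  ... | inj₂ (inj₁ refl) = py
  ... | inj₂ (inj₂ j)    = pz j

-- Ancestors, barren vertices, and S(G) without heads

module _ {n : ℕ} (G : ADMG n) where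

  dirE? : ∀ x y → Dec (DirE G x y)
  dirE? x y = dir G x y Bool.≟ true

  isAnc? : ∀ x y → Dec (IsAnc G x y)
  isAnc? = star? dirE?

  inAn? : ∀ X v → Dec (InAn G X v)
  inAn? X v = any? (λ w → (w ∈? X) ×-dec isAnc? v w)

  bidIn? : ∀ X x y → Dec (BidIn G X x y)
  bidIn? X x y = (bid G x y Bool.≟ true) ×-dec (inAn? X x ×-dec inAn? X y)

  InAn-self : ∀ {X v} → v ∈ X → InAn G X v
  InAn-self i = _ , i , ε

  InAn-step : ∀ {X u v} → IsAnc G u v → InAn G X v → InAn G X u
  InAn-step p (w , i , q) = w , i , p ◅◅ q

  InAn-mono : ∀ {X Y v} → (∀ {u} → u ∈ X → InAn G Y u) → InAn G X v → InAn G Y v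
  InAn-mono X⊆ (w , i , p) = InAn-step p (X⊆ i)

  no-cycle : ∀ {x y} → DirE G x y → IsAnc G y x → Empty
  no-cycle {x} e p = acyclic G x (plus e p)
    where
    plus : ∀ {x y z} → DirE G x y → Star (DirE G) y z → TransClosure (DirE G) x z
    plus e ε       = [ e ]
    plus e (f ◅ p) = e ∷ plus f p

  StrictAnc : Fin n → Fin n → Set
  StrictAnc x y = ∃ λ z → DirE G x z × IsAnc G z y

  strict⇒anc : ∀ {x y} → StrictAnc x y → IsAnc G x y
  strict⇒anc (_ , e , p) = e ◅ p

  strict-trans : ∀ {x y z} → StrictAnc x y → StrictAnc y z → StrictAnc x z
  strict-trans (u , e , p) q = u , e , p ◅◅ strict⇒anc q

  strict-asym : ∀ {x y} → StrictAnc x y → StrictAnc y x → Empty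
  strict-asym (_ , e , p) q = no-cycle e (p ◅◅ strict⇒anc q)

  rank : Fin n → ℕ
  rank v = ∣ comprehension (λ u → isAnc? u v) ∣

  rank-mono : ∀ {x y} → StrictAnc x y → rank x < rank y
  rank-mono {x} {y} s = p⊂q⇒∣p∣<∣q∣
    ( (λ i → ∈-comprehension⁺ (λ u → isAnc? u y) (∈-comprehension⁻ (λ u → isAnc? u x) i ◅◅ strict⇒anc s))
    , y , ∈-comprehension⁺ (λ u → isAnc? u y) ε
    , λ i → no-cycle (proj₁ (proj₂ s)) (proj₂ (proj₂ s) ◅◅ ∈-comprehension⁻ (λ u → isAnc? u x) i))

  rank≤n : ∀ v → rank v ≤ n
  rank≤n v = ∣p∣≤n (comprehension (λ u → isAnc? u v))

  -- For `h ∈ X` this is membership in the barren subset of X: a child of `h` in an(X) has a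
  -- descendant in X, which differs from `h` by acyclicity.
  Barren : Subset n → Fin n → Set
  Barren X h = ∀ {e} → DirE G h e → ¬ InAn G X e

  barren? : ∀ X h → Dec (Barren X h)
  barren? X h with any? (λ e → dirE? h e ×-dec inAn? X e)
  ... | yes (_ , h→e , e∈) = no (λ b → b h→e e∈)
  ... | no none            = yes (λ h→e e∈ → none (_ , h→e , e∈))

  -- Climb from `v` to strict descendants inside X. The rank grows at each step and never exceeds
  -- `n`, so the fuel `k` cannot run out early.
  barren-above : ∀ {X v} → v ∈ X → ∃ λ h → h ∈ X × Barren X h × IsAnc G v h
  barren-above {X} {v} = climb n v (m≤n+m n (rank v))
    where
    climb : ∀ k v → n ≤ rank v + k → v ∈ X → ∃ λ h → h ∈ X × Barren X h × IsAnc G v h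
    climb k v n≤ v∈ with any? (λ e → dirE? v e ×-dec inAn? X e)
    ... | no none = v , v∈ , (λ v→e e∈ → none (_ , v→e , e∈)) , ε
    climb zero v n≤ v∈ | yes (e , v→e , w , w∈ , p) = contradiction
      (≤-trans (rank-mono (e , v→e , p)) (≤-trans (rank≤n w) (subst (n ≤_) (+-identityʳ _) n≤)))
      (n≮n _)
    climb (suc k) v n≤ v∈ | yes (e , v→e , w , w∈ , p) =
      let h , h∈ , b , q = climb k w
            (≤-trans (subst (n ≤_) (+-suc _ k) n≤) (+-monoˡ-≤ k (rank-mono (e , v→e , p)))) w∈
      in h , h∈ , b , v→e ◅ p ◅◅ q

  -- For `d` in an(X), with D its district in the subgraph on an(X): `v` belongs to D ∪ pa(D).
  Hangs : Subset n → Fin n → Fin n → Set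
  Hangs X d v = ∃ λ e → Star (BidIn G X) d e × (v ≡ e ⊎ DirE G v e)

  hangs? : ∀ X d v → Dec (Hangs X d v)
  hangs? X d v = any? (λ e → star? (bidIn? X) d e ×-dec ((v ≟ e) ⊎-dec dirE? v e))

  Rooted : Subset n → Fin n → Set
  Rooted X d = ∀ {v} → v ∈ X → Hangs X d v

  -- A description of S(G) that does not mention heads and tails.
  InS′ : Subset n → Set
  InS′ X = ∃ λ d → InAn G X d × Rooted X d

  BidIn-sym : ∀ {X x y} → BidIn G X x y → BidIn G X y x
  BidIn-sym (e , i , j) = trans (bid-sym G _ _) e , j , i

  district-sym : ∀ {X x y} → Star (BidIn G X) x y → Star (BidIn G X) y x
  district-sym = reverse BidIn-sym

  district-⊆an : ∀ {X d e} → InAn G X d → Star (BidIn G X) d e → InAn G X e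
  district-⊆an i ε                 = i
  district-⊆an _ ((_ , _ , i) ◅ p) = district-⊆an i p

  district-mono : ∀ {X Y} → (∀ {u} → u ∈ X → InAn G Y u) →
                  ∀ {x y} → Star (BidIn G X) x y → Star (BidIn G Y) x y
  district-mono X⊆ = mapStar (λ (e , i , j) → e , InAn-mono X⊆ i , InAn-mono X⊆ j)

  hangs-mono : ∀ {X Y} → (∀ {u} → u ∈ X → InAn G Y u) → ∀ {d v} → Hangs X d v → Hangs Y d v
  hangs-mono X⊆ (e , p , r) = e , district-mono X⊆ p , r

  rooted-reroot : ∀ {X d d′} → Star (BidIn G X) d′ d → Rooted X d → Rooted X d′
  rooted-reroot p root i = let e , q , r = root i in e , p ◅◅ q , r

  -- A parent of a district member has a child in an(X), so a barren vertex can only hang by lying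
  -- in the district itself.
  hangs-barren : ∀ {X d h} → InAn G X d → Barren X h → Hangs X d h → Star (BidIn G X) d h
  hangs-barren i b (_ , p , inj₁ refl) = p
  hangs-barren i b (_ , p , inj₂ h→e)  = contradiction (district-⊆an i p) (b h→e)

  InS′-barren-root : ∀ {X h} → InS′ X → h ∈ X → Barren X h → Rooted X h
  InS′-barren-root (d , i , root) h∈ b =
    rooted-reroot (district-sym (hangs-barren i b (root h∈))) root

  -- The hypotheses give an(X) = an(Y), so the districts in question are the same.
  InS′-shrink : ∀ {X Y} → InS′ X → Y ⊆ X → (∀ {u} → u ∈ X → InAn G Y u) → InS′ Y
  InS′-shrink (d , i , root) Y⊆X X⊆anY =
    d , InAn-mono X⊆anY i , λ v∈ → hangs-mono X⊆anY (root (Y⊆X v∈))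

  InS⇒InS′ : ∀ {X} → InS G X → InS′ X
  InS⇒InS′ {X} (H , A , ((h , h∈) , _ , conn) , tail , refl) = h , InAn-self (H⊆ h∈) , root
    where
    H⊆ : H ⊆ X
    H⊆ i = x∈p∪q⁺ (inj₁ i)
    up : ∀ {x y} → Star (BidIn G H) x y → Star (BidIn G X) x y
    up = district-mono (InAn-self ∘ H⊆)
    root : Rooted X h
    root {v} i with x∈p∪q⁻ H A i
    ... | inj₁ v∈H = v , up (conn _ _ h∈ v∈H) , inj₁ refl
    ... | inj₂ v∈A with tail v v∈A
    ...   | inj₁ ((h′ , h′∈ , p) , _)       = v , up (conn _ _ h∈ h′∈ ◅◅ p) , inj₁ refl
    ...   | inj₂ (e , (h′ , h′∈ , p) , v→e) = e , up (conn _ _ h∈ h′∈ ◅◅ p) , inj₂ v→e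

  -- The head consists of the barren vertices of X, and `A` of the other vertices. Every vertex of X
  -- lies above a barren one, so an(H) = an(X), and all barren vertices share the district of `d`.
  InS′⇒InS : ∀ {X} → InS′ X → InS G X
  InS′⇒InS {X} (d , (x , x∈ , d≤x) , root) =
    H , A , ((h₀ , H⁺ h₀∈ h₀-barren) , barren , connected) , tail
      , ⊆-antisym split (λ i → [ proj₁ ∘ H⁻ , proj₁ ∘ A⁻ ]′ (x∈p∪q⁻ H A i))
    where
    H? : ∀ v → Dec (v ∈ X × Barren X v)
    H? v = (v ∈? X) ×-dec barren? X v
    H : Subset n
    H = comprehension H?
    H⁺ : ∀ {v} → v ∈ X → Barren X v → v ∈ H
    H⁺ i b = ∈-comprehension⁺ H? (i , λ {e} → b {e})
    H⁻ : ∀ {v} → v ∈ H → v ∈ X × Barren X v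
    H⁻ = ∈-comprehension⁻ H?
    A? : ∀ v → Dec (v ∈ X × v ∉ H)
    A? v = (v ∈? X) ×-dec ¬? (v ∈? H)
    A : Subset n
    A = comprehension A?
    A⁻ : ∀ {v} → v ∈ A → v ∈ X × v ∉ H
    A⁻ = ∈-comprehension⁻ A?
    split : X ⊆ H ∪ A
    split {v} i with v ∈? H
    ... | yes j = x∈p∪q⁺ (inj₁ j)
    ... | no  j = x∈p∪q⁺ (inj₂ (∈-comprehension⁺ A? (i , j)))
    d∈an : InAn G X d
    d∈an = x , x∈ , d≤x
    X⊆anH : ∀ {v} → v ∈ X → InAn G H v
    X⊆anH i = let h , h∈ , b , p = barren-above i in h , H⁺ h∈ b , p
    to-barren : ∀ {h} → h ∈ H → Star (BidIn G H) d h
    to-barren i = let h∈ , b = H⁻ i in district-mono X⊆anH (hangs-barren d∈an b (root h∈))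
    h₀ : Fin n
    h₀ = proj₁ (barren-above x∈)
    h₀∈ : h₀ ∈ X
    h₀∈ = proj₁ (proj₂ (barren-above x∈))
    h₀-barren : Barren X h₀
    h₀-barren = proj₁ (proj₂ (proj₂ (barren-above x∈)))
    barren : IsBarrenSet G H
    barren h w _ _ ε             = refl
    barren h w i j (h→e ◅ e≤w) = contradiction (w , proj₁ (H⁻ j) , e≤w) (proj₂ (H⁻ i) h→e)
    connected : ∀ h h′ → h ∈ H → h′ ∈ H → Star (BidIn G H) h h′
    connected h h′ i j = district-sym (to-barren i) ◅◅ to-barren j
    in-district : ∀ {e} → Star (BidIn G X) d e → InDisAnH G H e
    in-district p =
      h₀ , H⁺ h₀∈ h₀-barren , district-sym (to-barren (H⁺ h₀∈ h₀-barren)) ◅◅ district-mono X⊆anH p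
    tail : ∀ v → v ∈ A → InTail G H v
    tail v i with root (proj₁ (A⁻ i))
    ... | _ , p , inj₁ refl = inj₁ (in-district p , proj₂ (A⁻ i))
    ... | e , p , inj₂ v→e  = inj₂ (e , in-district p , v→e)

-- m-connecting walks and their reduction to paths

module _ {n : ℕ} (G : ADMG n) (C : Subset n) where

  Junction : Kind G → Kind G → Fin n → Set
  Junction k k′ y = if headAtEnd G k ∧ headAtStart G k′ then InAn G C y else y ∉ C

  junction-fwd⁻ : ∀ k {y} → Junction k fwd y → y ∉ C
  junction-fwd⁻ fwd j = j
  junction-fwd⁻ bwd j = j
  junction-fwd⁻ bi  j = j

  junction-fwd⁺ : ∀ k {y} → y ∉ C → Junction k fwd y
  junction-fwd⁺ fwd y∉ = y∉
  junction-fwd⁺ bwd y∉ = y∉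
  junction-fwd⁺ bi  y∉ = y∉

  junction-heads⁻ : ∀ {k k′ y} → headAtEnd G k ≡ true → headAtStart G k′ ≡ true →
                   Junction k k′ y → InAn G C y
  junction-heads⁻ {k} {k′} p q j with headAtEnd G k | headAtStart G k′
  junction-heads⁻ refl refl j | true | true = j

  junction-heads⁺ : ∀ {k k′ y} → headAtEnd G k ≡ true → headAtStart G k′ ≡ true →
                    InAn G C y → Junction k k′ y
  junction-heads⁺ {k} {k′} p q i with headAtEnd G k | headAtStart G k′
  junction-heads⁺ refl refl i | true | true = i

  junction-an : ∀ k k′ {y} → InAn G C y → (headAtEnd G k ∧ headAtStart G k′ ≡ false → y ∉ C) →
                Junction k k′ y
  junction-an k k′ i f with headAtEnd G k ∧ headAtStart G k′
  ... | true  = i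
  ... | false = f refl

  interior⇒mconn : ∀ {k y} s → InteriorOK G C k y s → MConnOK G C s
  interior⇒mconn []      _        = tt
  interior⇒mconn (_ ∷ _) (_ , ok) = ok

  -- After entering `y` through an arrowhead, the walk follows directed edges until it either
  -- reaches `a` or meets its first collider, which is a descendant of `y` in an(C).
  open-descends : ∀ k y s {a} → headAtEnd G k ≡ true → ValidSteps G y s → InteriorOK G C k y s →
                  a List.∈ vertices G y s → InAn G C y ⊎ IsAnc G y a
  open-descends k y s                h v       ok      (here refl) = inj₂ ε
  open-descends k y ((k′ , z) ∷ s) h (e , v) (j , ok) (there i) with k′
  ... | bwd = inj₁ (junction-heads⁻ {k} {bwd} h refl j)
  ... | bi  = inj₁ (junction-heads⁻ {k} {bi} h refl j)
  ... | fwd = [ inj₁ ∘ InAn-step G (e ◅ ε) , (λ p → inj₂ (e ◅ p)) ]′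
                (open-descends fwd z s refl v ok i)

  suffix : ∀ k y s {a} → a List.∈ vertices G y s → ValidSteps G y s → Unique (vertices G y s) →
           InteriorOK G C k y s →
           ∃ λ k′ → ∃ λ s′ → ValidSteps G a s′ × Unique (vertices G a s′)
             × lastV G a s′ ≡ lastV G y s × InteriorOK G C k′ a s′
  suffix k y s (here refl) v u ok = k , s , v , u , refl , ok
  suffix k y ((k′ , z) ∷ s) (there i) (_ , v) (_ ∷ u) (_ , ok) = suffix k′ z s i v u ok

  lastV∈vertices : ∀ y s → lastV G y s List.∈ vertices G y s
  lastV∈vertices y []            = here refl
  lastV∈vertices y ((_ , z) ∷ s) = there (lastV∈vertices z s)

  -- Cutting a loop at y can turn y into a collider only if the walk left y by
  -- y → x; since it came back to y, it has a collider below x, so y ∈ an(C).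
  loop-junction : ∀ k k₁ k′ k″ {y} → Junction k k₁ y → Junction k″ k′ y →
                  (k₁ ≡ fwd → InAn G C y) → Junction k k′ y
  loop-junction k fwd k′  k″ j _  f = junction-an k k′ (f refl) (λ _ → junction-fwd⁻ k j)
  loop-junction k bwd fwd k″ _ j″ _ = junction-fwd⁺ k (junction-fwd⁻ k″ j″)
  loop-junction k bi  fwd k″ _ j″ _ = junction-fwd⁺ k (junction-fwd⁻ k″ j″)
  loop-junction k bwd bwd k″ j _  _ = j
  loop-junction k bwd bi  k″ j _  _ = j
  loop-junction k bi  bwd k″ j _  _ = j
  loop-junction k bi  bi  k″ j _  _ = j

  -- The last conjunct strengthens the induction: a step put in front of the shortened walk must
  -- remain open at the junction.
  erase-loops : ∀ y s → ValidSteps G y s → MConnOK G C s →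
    ∃ λ s′ → ValidSteps G y s′ × Unique (vertices G y s′) × lastV G y s′ ≡ lastV G y s
      × MConnOK G C s′ × (∀ k → InteriorOK G C k y s → InteriorOK G C k y s′)
  erase-loops y [] v ok = [] , tt , [] ∷ [] , refl , tt , λ _ _ → tt
  erase-loops y ((k₁ , x) ∷ s) (e , v) ok with erase-loops x s v (interior⇒mconn s ok)
  ... | s′ , v′ , u′ , l′ , _ , pres with memberOf? _≟_ y (vertices G x s′)
  ...   | no y∉ = (k₁ , x) ∷ s′ , (e , v′) , ¬Any⇒All¬ _ y∉ ∷ u′ , l′ , pres k₁ ok
                , λ _ (j , _) → j , pres k₁ ok
  ...   | yes y∈ with suffix k₁ x s′ y∈ v′ u′ (pres k₁ ok)
  ...     | k″ , s″ , v″ , u″ , l″ , ok″ =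
    s″ , v″ , u″ , trans l″ l′ , interior⇒mconn s″ ok″ , λ k (j , _) → rejoin k s″ j ok″
    where
    below : k₁ ≡ fwd → InAn G C y
    below refl = [ InAn-step G (e ◅ ε) , ⊥-elim ∘ no-cycle G e ]′
      (open-descends fwd x s′ refl v′ (pres fwd ok) y∈)
    rejoin : ∀ k t → Junction k k₁ y → InteriorOK G C k″ y t → InteriorOK G C k y t
    rejoin k []            _ _          = tt
    rejoin k ((k′ , _) ∷ t) j (j″ , ok) = loop-junction k k₁ k′ k″ j j″ below , ok

  walk⇒path : ∀ {a b} s → ValidSteps G a s → lastV G a s ≡ b → MConnOK G C s → MConnecting G C a b
  walk⇒path s v l ok with erase-loops _ s v ok
  ... | s′ , v′ , u′ , l′ , ok′ , _ = s′ , v′ , u′ , trans l′ l , ok′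

-- Composing collider paths inside an({a , b} ∪ C), assuming no open walk from a to b

module ColliderWalks {n : ℕ} (G : ADMG n) (C : Subset n) (a b : Fin n)
  (no-walk : ∀ s → ValidSteps G a s → lastV G a s ≡ b → ¬ MConnOK G C s) where

  T : Subset n
  T = triple a b C

  StartsWithHead : Steps G → Set
  StartsWithHead []            = ⊤
  StartsWithHead ((k , _) ∷ _) = headAtStart G k ≡ true

  -- `Q` lists the kinds of edge by which `y` may be entered; one walk has to stay open at `y` for
  -- all of them.
  OpenIf : (Kind G → Set) → Fin n → Set
  OpenIf Q y = ∃ λ s → ValidSteps G y s × lastV G y s ≡ b × (∀ k → Q k → InteriorOK G C k y s)

  IntoHead AnyKind : Kind G → Set
  IntoHead k = headAtEnd G k ≡ true
  AnyKind  _ = ⊤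

  walk-down : ∀ {y} → IsAnc G y b → ¬ InAn G C y → OpenIf AnyKind y
  walk-down ε y∉ = [] , tt , refl , λ _ _ → tt
  walk-down (_◅_ {j = z} e p) y∉ with walk-down p (y∉ ∘ InAn-step G (e ◅ ε))
  ... | s , v , l , ok = (fwd , z) ∷ s , (e , v) , l , open-fwd
    where
    open-fwd : ∀ k → ⊤ → InteriorOK G C k _ ((fwd , z) ∷ s)
    open-fwd k _ = junction-fwd⁺ G C k (y∉ ∘ InAn-self G) , ok fwd tt

  -- Traversing the directed path backwards from `a` to `y` meets only noncolliders outside C, so
  -- prefixing it to `s` would give the walk that `no-walk` excludes.
  no-walk-up : ∀ {y} → IsAnc G y a → ¬ InAn G C y → ∀ s → ValidSteps G y s → lastV G y s ≡ b →
               ¬ InteriorOK G C bwd y s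
  no-walk-up ε y∉ s v l ok = no-walk s v l (interior⇒mconn G C s ok)
  no-walk-up {y} (e ◅ p) y∉ s v l ok =
    no-walk-up p z∉ ((bwd , y) ∷ s) (e , v) l (z∉ ∘ InAn-self G , ok)
    where z∉ = y∉ ∘ InAn-step G (e ◅ ε)

  -- A collider at y ∈ an(C) is harmless; one at y ∉ an(C) is avoided by
  -- leaving y along a directed path to b, or by entering it from a directed
  -- path from y to a.
  open-at : ∀ {y} → InAn G T y → (Q : Kind G → Set) → ∀ s → ValidSteps G y s → lastV G y s ≡ b →
            MConnOK G C s →
            (∀ k → Q k → InAn G C y → InteriorOK G C k y s) → OpenIf Q y
  open-at {y} i Q s v l ok f with inAn? G C y
  ... | yes y∈ = s , v , l , λ k q → f k q y∈
  ... | no y∉ with i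
  ...   | w , w∈ , p with ∈-triple⁻ w∈
  ...     | inj₁ refl        = contradiction (unblocked s ok) (no-walk-up p y∉ s v l)
    where
    unblocked : ∀ s → MConnOK G C s → InteriorOK G C bwd y s
    unblocked []      _  = tt
    unblocked (_ ∷ _) ok = y∉ ∘ InAn-self G , ok
  ...     | inj₂ (inj₁ refl) = let s′ , v′ , l′ , ok′ = walk-down p y∉ in s′ , v′ , l′ , λ k _ → ok′ k tt
  ...     | inj₂ (inj₂ w∈C)  = contradiction (w , w∈C , p) y∉

  open-into-head : ∀ {y} → InAn G T y → ∀ s → ValidSteps G y s → lastV G y s ≡ b →
                   MConnOK G C s → StartsWithHead s → OpenIf IntoHead y
  open-into-head i s v l ok h = open-at i IntoHead s v l ok (collider s h ok)
    where
    collider : ∀ {y} s → StartsWithHead s → MConnOK G C s →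
               ∀ k → IntoHead k → InAn G C y → InteriorOK G C k y s
    collider []      _ _  _ _ _ = tt
    collider ((k′ , _) ∷ _) h ok k h′ y∈ = junction-heads⁺ G C {k} {k′} h′ h y∈ , ok

  open-any : ∀ {y} → InAn G T y → y ∉ C → ∀ s → ValidSteps G y s → lastV G y s ≡ b →
             MConnOK G C s → OpenIf AnyKind y
  open-any i y∉C s v l ok = open-at i AnyKind s v l ok (either s ok)
    where
    either : ∀ s → MConnOK G C s → ∀ k → ⊤ → InAn G C _ → InteriorOK G C k _ s
    either []             _  _ _ _  = tt
    either ((k′ , _) ∷ _) ok k _ y∈ = junction-an G C k k′ y∈ (λ _ → y∉C) , ok

  along-district : ∀ {X x y} → (∀ {v} → v ∈ X → InAn G T v) → InAn G T x → Star (BidIn G X) x y →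
                   OpenIf IntoHead y → OpenIf IntoHead x
  along-district X⊆ i ε w = w
  along-district X⊆ i ((e , _ , j) ◅ p) w with along-district X⊆ (InAn-mono G X⊆ j) p w
  ... | s , v , l , ok = open-into-head i ((bi , _) ∷ s) (e , v) l (ok bi refl) refl

  -- Both `x` and `y` are in, or are parents of, the district of `d`. Going through that district
  -- joins them by a collider path in an(T), and `open-at` deals with colliders outside an(C).
  along-district-set : ∀ {x y X} → InS′ G X → x ∈ X → y ∈ X → (∀ {v} → v ∈ X → InAn G T v) →
                       x ∉ C → OpenIf AnyKind y → OpenIf AnyKind x
  along-district-set {x} {y} {X} (d , d∈ , root) x∈ y∈ X⊆ x∉C (s , v , l , ok)
    with root x∈ | root y∈
  ... | e , p , r | e′ , p′ , r′ =
    leave r (along-district X⊆ (anT p) (district-sym G p ◅◅ p′) (enter r′))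
    where
    anT : ∀ {e} → Star (BidIn G X) d e → InAn G T e
    anT p = InAn-mono G X⊆ (district-⊆an G d∈ p)
    enter : y ≡ e′ ⊎ DirE G y e′ → OpenIf IntoHead e′
    enter (inj₁ refl) = s , v , l , λ k _ → ok k tt
    enter (inj₂ y→e′) = open-into-head (anT p′) ((bwd , y) ∷ s) (y→e′ , v) l (ok bwd tt) refl
    leave : x ≡ e ⊎ DirE G x e → OpenIf IntoHead e → OpenIf AnyKind x
    leave (inj₁ refl) (t , v , l , ok) =
      open-any (X⊆ x∈) x∉C t v l (interior⇒mconn G C t (ok fwd refl))
    leave (inj₂ x→e)  (t , v , l , ok) =
      open-any (X⊆ x∈) x∉C ((fwd , e) ∷ t) (x→e , v) l (ok fwd refl)

-- Chains of members of S(G) from an m-connecting walk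

-- Links x — y, given by sets {x , y} ∪ Z in S(G) with Z ⊆ C, joined in a row
-- from x to b.  At every interior vertex y, one of the two adjacent links
-- witnesses that y is a strict ancestor of another vertex of that link.
module Chains {n : ℕ} (G : ADMG n) (C : Subset n) (b : Fin n) where

  Link : Fin n → Fin n → Subset n → Set
  Link x y Z = Z ⊆ C × InS′ G (triple x y Z)

  Tip : Fin n → Fin n → Subset n → Set
  Tip x y Z = ∃ λ u → (u ≡ y ⊎ u ∈ Z) × StrictAnc G x u

  -- The indices expose the first link, since the tip of its initial vertex may refer to it once
  -- another link is put in front.
  data Chain (P : Fin n → Set) : Fin n → Fin n → Subset n → Set where
    last : ∀ {x Z} → Link x b Z → Chain P x b Z
    _∷⟨_,_⟩_ : ∀ {x y Z w Z′} → Link x y Z → P y → Tip y x Z ⊎ Tip y w Z′ →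
               Chain P y w Z′ → Chain P x y Z

  infixr 5 _∷⟨_,_⟩_

  relink : ∀ {P x y Z Z′ w} → Chain P y w Z → Link x w Z′ → (Tip w y Z → Tip w x Z′) →
           Chain P x w Z′
  relink (last _)             l f = last l
  relink (_ ∷⟨ p , t ⟩ rest) l f = l ∷⟨ p , [ inj₁ ∘ f , inj₂ ]′ t ⟩ rest

  near : ∀ {x y} Z → DirE G x y → Tip x y Z
  near Z e = _ , inj₁ refl , _ , e , ε

  self-bid : ∀ {X x y} → bid G x y ≡ true → x ∈ X → y ∈ X → Star (BidIn G X) x y
  self-bid e i j = (e , InAn-self G i , InAn-self G j) ◅ ε

  pair-rooted₁ : ∀ {x y} → DirE G y x ⊎ bid G x y ≡ true → Rooted G (triple x y ⊥) x
  pair-rooted₁ {x} {y} r =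
    triple-elim (Hangs G (triple x y ⊥) x) (x , ε , inj₁ refl) (hang r) (⊥-elim ∘ ∉⊥)
    where
    hang : DirE G y x ⊎ bid G x y ≡ true → Hangs G (triple x y ⊥) x y
    hang (inj₁ y→x) = x , ε , inj₂ y→x
    hang (inj₂ x↔y) = y , self-bid x↔y (∈-triple₁ ⊥) (∈-triple₂ x ⊥) , inj₁ refl

  pair-rooted₂ : ∀ {x y} → DirE G x y ⊎ bid G x y ≡ true → Rooted G (triple x y ⊥) y
  pair-rooted₂ {x} {y} r =
    triple-elim (Hangs G (triple x y ⊥) y) (hang r) (y , ε , inj₁ refl) (⊥-elim ∘ ∉⊥)
    where
    hang : DirE G x y ⊎ bid G x y ≡ true → Hangs G (triple x y ⊥) y x
    hang (inj₁ x→y) = y , ε , inj₂ x→y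
    hang (inj₂ x↔y) = x , self-bid (trans (bid-sym G y x) x↔y) (∈-triple₂ x ⊥) (∈-triple₁ ⊥) , inj₁ refl

  edge-link : ∀ k {x y} → Edge G k x y → Link x y ⊥
  edge-link fwd {x} {y} e = ⊥-elim ∘ ∉⊥ , y , InAn-self G (∈-triple₂ x ⊥) , pair-rooted₂ (inj₁ e)
  edge-link bwd {x} {y} e = ⊥-elim ∘ ∉⊥ , x , InAn-self G (∈-triple₁ ⊥) , pair-rooted₁ (inj₁ e)
  edge-link bi  {x} {y} e = ⊥-elim ∘ ∉⊥ , x , InAn-self G (∈-triple₁ ⊥) , pair-rooted₁ (inj₂ e)

  module _ (P : Fin n → Set) (outside : ∀ {y} → y ∉ C → P y) where

    -- A link from `y` to itself, rooted at `c`, that supplies a tip for `y`.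
    child-loop : ∀ {y c} → DirE G y c → c ∈ C → Link y y ⁅ c ⁆
    child-loop {y} {c} e c∈ =
      (λ i → subst (_∈ C) (sym (x∈⁅y⁆⇒x≡y c i)) c∈) , c , InAn-self G (∈-triple₃ (x∈⁅x⁆ c))
      , triple-elim (Hangs G (triple y y ⁅ c ⁆) c) (c , ε , inj₂ e) (c , ε , inj₂ e)
          (λ i → c , ε , inj₁ (x∈⁅y⁆⇒x≡y c i))

    -- Walking from y down to C and back gives y a tip.
    detour : ∀ {y c} → IsAnc G y c → c ∈ C → y ∉ C → ∀ {w Z} → Chain P y w Z →
             ∃ λ w′ → ∃ λ Z′ → Chain P y w′ Z′ × Tip y w′ Z′
    detour ε c∈ y∉ rest = contradiction c∈ y∉
    detour {y} (_◅_ {j = z} e p) c∈ y∉ rest with z ∈? C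
    -- The descent turns round at its last vertex before C, by a link from that vertex to itself.
    ... | yes z∈ = y , ⁅ z ⁆ , child-loop e z∈ ∷⟨ outside y∉ , inj₁ tip ⟩ rest , tip
      where
      tip : Tip y y ⁅ z ⁆
      tip = z , inj₂ (x∈⁅x⁆ z) , z , e , ε
    ... | no z∉ with detour p c∈ z∉ (edge-link bwd e ∷⟨ outside y∉ , inj₁ (near ⊥ e) ⟩ rest)
    ...   | w′ , Z′ , chain , tip =
      z , ⊥ , edge-link fwd e ∷⟨ outside z∉ , inj₂ tip ⟩ chain , near ⊥ e

    -- What the preceding vertex of the walk needs. If the edge of kind `k` points out of `x`, the
    -- tip lets `x` be an interior vertex; if it has an arrowhead at `x`, the rooting lets a
    -- collider `x` in C be absorbed into a link.
    Start : Fin n → Kind G → Set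
    Start x k = ∃ λ w → ∃ λ Z → Chain P x w Z × (k ≡ fwd → Tip x w Z)
      × (headAtStart G k ≡ true → Rooted G (triple x w Z) x)

    start-rooted : ∀ k {x y} → Edge G k x y → headAtStart G k ≡ true → Rooted G (triple x y ⊥) x
    start-rooted bwd e _ = pair-rooted₁ (inj₁ e)
    start-rooted bi  e _ = pair-rooted₁ (inj₂ e)

    fwd-tip : ∀ k {x y} → Edge G k x y → k ≡ fwd → Tip x y ⊥
    fwd-tip fwd e _ = near ⊥ e

    through : ∀ k {x y w Z′} → Edge G k x y → P y → Chain P y w Z′ → Tip y x ⊥ ⊎ Tip y w Z′ → Start x k
    through k e p rest tip =
      _ , ⊥ , edge-link k e ∷⟨ p , tip ⟩ rest , fwd-tip k e , start-rooted k e

    -- A collider `y` in C does not become a chain vertex but joins `Z`. The link stays in S(G)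
    -- because `x` is a parent or a bidirected neighbour of the root `y`.
    absorb : ∀ k {x y w Z} → Edge G k x y → headAtEnd G k ≡ true → y ∈ C →
             Chain P y w Z → Z ⊆ C → Rooted G (triple y w Z) y → Start x k
    absorb k {x} {y} {w} {Z} e h y∈ rest Z⊆C root =
      w , Y , relink rest (Y⊆C , y , InAn-self G y∈X , rooted) keep , tip k e , rooted-x k e h
      where
      Y : Subset n
      Y = ⁅ y ⁆ ∪ Z
      X : Subset n
      X = triple x w Y
      y∈Y : y ∈ Y
      y∈Y = x∈p∪q⁺ (inj₁ (x∈⁅x⁆ y))
      y∈X : y ∈ X
      y∈X = ∈-triple₃ y∈Y
      Y⊆C : Y ⊆ C
      Y⊆C i = [ (λ j → subst (_∈ C) (sym (x∈⁅y⁆⇒x≡y y j)) y∈) , Z⊆C ]′ (x∈p∪q⁻ ⁅ y ⁆ Z i)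
      lift : ∀ {v} → v ∈ triple y w Z → Hangs G X y v
      lift i = hangs-mono G (triple-elim (InAn G X) (InAn-self G y∈X) (InAn-self G (∈-triple₂ x Y))
                 (λ j → InAn-self G (∈-triple₃ (x∈p∪q⁺ (inj₂ j))))) (root i)
      hang-x : ∀ k → Edge G k x y → headAtEnd G k ≡ true → Hangs G X y x
      hang-x fwd e _ = y , ε , inj₂ e
      hang-x bi  e _ = x , self-bid (trans (bid-sym G y x) e) y∈X (∈-triple₁ Y) , inj₁ refl
      rooted : Rooted G X y
      rooted = triple-elim (Hangs G X y) (hang-x k e h) (lift (∈-triple₂ y Z))
        (λ i → [ (λ j → y , ε , inj₁ (x∈⁅y⁆⇒x≡y y j)) , lift ∘ ∈-triple₃ ]′ (x∈p∪q⁻ ⁅ y ⁆ Z i))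
      keep : Tip w y Z → Tip w x Y
      keep (u , inj₁ refl , s) = u , inj₂ y∈Y , s
      keep (u , inj₂ u∈ , s)   = u , inj₂ (x∈p∪q⁺ (inj₂ u∈)) , s
      tip : ∀ k → Edge G k x y → k ≡ fwd → Tip x w Y
      tip fwd e _ = y , inj₂ y∈Y , y , e , ε
      rooted-x : ∀ k → Edge G k x y → headAtEnd G k ≡ true → headAtStart G k ≡ true → Rooted G X x
      rooted-x bi e _ _ = rooted-reroot G (self-bid e (∈-triple₁ Y) y∈X) rooted

    link-⊆C : ∀ {x w Z} → Chain P x w Z → Z ⊆ C
    link-⊆C (last (Z⊆ , _))          = Z⊆
    link-⊆C ((Z⊆ , _) ∷⟨ _ , _ ⟩ _) = Z⊆

    -- Induction from the end of the walk. Noncolliders become chain vertices, with a tip along an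
    -- outgoing edge; colliders in C are absorbed, and other colliders get a tip from a detour to C.
    toChain : ∀ k x y s → Edge G k x y → ValidSteps G y s → lastV G y s ≡ b → InteriorOK G C k y s →
              Start x k
    toChain k x y [] e _ refl _ = b , ⊥ , last (edge-link k e) , fwd-tip k e , start-rooted k e
    toChain k x y ((k′ , z) ∷ s) e (e′ , v) l (j , ok) with toChain k′ y z s e′ v l ok
    ... | w , Z , rest , tip , root = join k k′ e j tip root
      where
      collider : ∀ k → Edge G k x y → headAtEnd G k ≡ true → InAn G C y →
                 Rooted G (triple y w Z) y → Start x k
      collider k e h (c , c∈ , p) root with y ∈? C
      ... | yes y∈ = absorb k e h y∈ rest (link-⊆C rest) root
      ... | no y∉ with detour p c∈ y∉ rest
      ...   | _ , _ , rest′ , tip = through k e (outside y∉) rest′ (inj₂ tip)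
      join : ∀ k k′ → Edge G k x y → Junction G C k k′ y → (k′ ≡ fwd → Tip y w Z) →
             (headAtStart G k′ ≡ true → Rooted G (triple y w Z) y) → Start x k
      join bwd k′  e j _   _    = through bwd e (outside j) rest (inj₁ (near ⊥ e))
      join fwd fwd e j tip _    = through fwd e (outside j) rest (inj₂ (tip refl))
      join bi  fwd e j tip _    = through bi  e (outside j) rest (inj₂ (tip refl))
      join fwd bwd e j _   root = collider fwd e refl j (root refl)
      join fwd bi  e j _   root = collider fwd e refl j (root refl)
      join bi  bwd e j _   root = collider bi  e refl j (root refl)
      join bi  bi  e j _   root = collider bi  e refl j (root refl)

-- Moving a chain into the ancestors of {a , b} ∪ C in the other graph

SameInS′ : ∀ {n} → ADMG n → ADMG n → Set
SameInS′ G₁ G₂ = ∀ {X} → (InS′ G₁ X → InS′ G₂ X) × (InS′ G₂ X → InS′ G₁ X)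

module Transfer {n : ℕ} (G₁ G₂ : ADMG n)
  (same : SameInS′ G₁ G₂)
  (C : Subset n) (a b : Fin n) where

  open Chains G₁ C b

  T : Subset n
  T = triple a b C

  -- The bound `m` is lowered step by step; at 0 only the ancestors of T in `G₂` remain.
  Low : ℕ → Fin n → Set
  Low m y = InAn G₂ T y ⊎ rank G₂ y < m

  Stage : ℕ → Fin n → Set
  Stage m y = y ∉ C × Low m y

  -- When `y` is dropped, a tip of `x` that pointed to `y` is prolonged by the tip of `y`; that one
  -- cannot be `x`, by acyclicity.
  tip-union : ∀ {x y w Z Z′} → Tip y x Z ⊎ Tip y w Z′ → Tip x y Z → Tip x w (Z ∪ Z′)
  tip-union t (u , inj₂ u∈ , s) = u , inj₂ (x∈p∪q⁺ (inj₁ u∈)) , s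
  tip-union (inj₁ (u , inj₁ refl , s′)) (_ , inj₁ refl , s) = contradiction s (strict-asym G₁ s′)
  tip-union (inj₁ (u , inj₂ u∈ , s′))   (_ , inj₁ refl , s) =
    u , inj₂ (x∈p∪q⁺ (inj₁ u∈)) , strict-trans G₁ s s′
  tip-union (inj₂ (u , inj₁ u≡w , s′))  (_ , inj₁ refl , s) = u , inj₁ u≡w , strict-trans G₁ s s′
  tip-union (inj₂ (u , inj₂ u∈ , s′))   (_ , inj₁ refl , s) =
    u , inj₂ (x∈p∪q⁺ (inj₂ u∈)) , strict-trans G₁ s s′

  tip-unionʳ : ∀ {x y w Z Z′} → Tip y x Z ⊎ Tip y w Z′ → Tip w y Z′ → Tip w x (Z ∪ Z′)
  tip-unionʳ t (u , inj₂ u∈ , s) = u , inj₂ (x∈p∪q⁺ (inj₂ u∈)) , s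
  tip-unionʳ (inj₂ (u , inj₁ refl , s′)) (_ , inj₁ refl , s) = contradiction s (strict-asym G₁ s′)
  tip-unionʳ (inj₂ (u , inj₂ u∈ , s′))   (_ , inj₁ refl , s) =
    u , inj₂ (x∈p∪q⁺ (inj₂ u∈)) , strict-trans G₁ s s′
  tip-unionʳ (inj₁ (u , inj₁ u≡w , s′))  (_ , inj₁ refl , s) = u , inj₁ u≡w , strict-trans G₁ s s′
  tip-unionʳ (inj₁ (u , inj₂ u∈ , s′))   (_ , inj₁ refl , s) =
    u , inj₂ (x∈p∪q⁺ (inj₁ u∈)) , strict-trans G₁ s s′

  -- In G₂ the vertex y is barren in the union of the two links, so the union
  -- is in S(G₂) = S(G₁); in G₁ it is not barren, so it can be dropped.
  merge : ∀ {x y w Z Z′} → ¬ InAn G₂ T y → Low (suc (rank G₂ y)) x → Low (suc (rank G₂ y)) w →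
          Tip y x Z ⊎ Tip y w Z′ → Link x y Z → Link y w Z′ → Link x w (Z ∪ Z′)
  merge {x} {y} {w} {Z} {Z′} y∉ lx lw tip (Z⊆C , xy) (Z′⊆C , yw) =
    (λ i → [ Z⊆C , Z′⊆C ]′ (x∈p∪q⁻ Z Z′ i)) , InS′-shrink G₁ union₁ Y⊆U U⊆an
    where
    U Y : Subset n
    U = triple x y Z ∪ triple y w Z′
    Y = triple x w (Z ∪ Z′)
    U-elim : (Q : Fin n → Set) → Q x → Q y → Q w → (∀ {v} → v ∈ Z → Q v) → (∀ {v} → v ∈ Z′ → Q v) →
             ∀ {v} → v ∈ U → Q v
    U-elim Q qx qy qw qz qz′ i =
      [ triple-elim Q qx qy qz , triple-elim Q qy qw qz′ ]′ (x∈p∪q⁻ (triple x y Z) _ i)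
    low : ∀ {v} → v ∈ U → Low (suc (rank G₂ y)) v
    low = U-elim (Low _) lx (inj₂ ≤-refl) lw (in-C ∘ Z⊆C) (in-C ∘ Z′⊆C)
      where
      in-C : ∀ {v} → v ∈ C → Low (suc (rank G₂ y)) v
      in-C i = inj₁ (InAn-self G₂ (∈-triple₃ i))
    barren : Barren G₂ U y
    -- A strict descendant of `y` in U would either put `y` into an(T) or have rank above the bound
    -- in `low`.
    barren y→e (v , v∈ , p) with low v∈
    ... | inj₁ i = y∉ (InAn-step G₂ (y→e ◅ p) i)
    ... | inj₂ r = contradiction (≤-trans r (rank-mono G₂ (_ , y→e , p))) (n≮n _)
    ∈U₁ : ∀ {v} → v ∈ triple x y Z → v ∈ U
    ∈U₁ i = x∈p∪q⁺ (inj₁ i)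
    ∈U₂ : ∀ {v} → v ∈ triple y w Z′ → v ∈ U
    ∈U₂ i = x∈p∪q⁺ (inj₂ i)
    hang : ∀ {X} → InS′ G₂ X → X ⊆ U → y ∈ X → ∀ {v} → v ∈ X → Hangs G₂ U y v
    hang X∈S X⊆U y∈ i = hangs-mono G₂ (InAn-self G₂ ∘ X⊆U)
      (InS′-barren-root G₂ X∈S y∈ (λ y→e → barren y→e ∘ InAn-mono G₂ (InAn-self G₂ ∘ X⊆U)) i)
    y∈U : y ∈ U
    y∈U = ∈U₂ (∈-triple₁ Z′)
    union₁ : InS′ G₁ U
    -- In `G₂` both links can be rooted at the barren vertex `y`, and so can their union.
    union₁ = proj₂ same (y , InAn-self G₂ y∈U ,
      λ i → [ hang (proj₁ same xy) ∈U₁ (∈-triple₂ x Z) , hang (proj₁ same yw) ∈U₂ (∈-triple₁ Z′) ]′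
              (x∈p∪q⁻ (triple x y Z) _ i))
    Y⊆U : Y ⊆ U
    Y⊆U = triple-elim (_∈ U) (∈U₁ (∈-triple₁ Z)) (∈U₂ (∈-triple₂ y Z′))
      (λ i → [ ∈U₁ ∘ ∈-triple₃ , ∈U₂ ∘ ∈-triple₃ ]′ (x∈p∪q⁻ Z Z′ i))
    x∈Y : x ∈ Y
    x∈Y = ∈-triple₁ (Z ∪ Z′)
    w∈Y : w ∈ Y
    w∈Y = ∈-triple₂ x (Z ∪ Z′)
    below : ∀ {u} → u ∈ Y → StrictAnc G₁ y u → InAn G₁ Y y
    below i s = _ , i , strict⇒anc G₁ s
    y-an : Tip y x Z ⊎ Tip y w Z′ → InAn G₁ Y y
    y-an (inj₁ (u , inj₁ refl , s)) = below x∈Y s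
    y-an (inj₁ (u , inj₂ u∈ , s))   = below (∈-triple₃ (x∈p∪q⁺ (inj₁ u∈))) s
    y-an (inj₂ (u , inj₁ refl , s)) = below w∈Y s
    y-an (inj₂ (u , inj₂ u∈ , s))   = below (∈-triple₃ (x∈p∪q⁺ (inj₂ u∈))) s
    U⊆an : ∀ {v} → v ∈ U → InAn G₁ Y v
    U⊆an = U-elim (InAn G₁ Y) (InAn-self G₁ x∈Y) (y-an tip) (InAn-self G₁ w∈Y)
      (λ i → InAn-self G₁ (∈-triple₃ (x∈p∪q⁺ (inj₁ i))))
      (λ i → InAn-self G₁ (∈-triple₃ (x∈p∪q⁺ (inj₂ i))))

  Lowered : ℕ → Fin n → Fin n → Subset n → Set
  Lowered m x w Z = ∃ λ w′ → ∃ λ Z′ → Chain (Stage m) x w′ Z′ × (Tip x w Z → Tip x w′ Z′)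

  -- Vertices are treated from the `b` end. The tip of `x` is carried along because the vertex
  -- before the chain's tail may be kept or merged on its strength.
  lower : ∀ {m x w Z} → Low (suc m) x → Chain (Stage (suc m)) x w Z → Lowered m x w Z
  lower lx (last l) = _ , _ , last l , λ t → t
  lower {m} {x} {y} {Z} lx (l ∷⟨ (y∉C , ly) , t ⟩ rest) with lower ly rest
  ... | w , Z′ , rest′ , keep = attach (inAn? G₂ T y) ly rest′
    where
    t′ : Tip y x Z ⊎ Tip y w Z′
    t′ = [ inj₁ , inj₂ ∘ keep ]′ t
    attach : Dec (InAn G₂ T y) → Low (suc m) y → Chain (Stage m) y w Z′ → Lowered m x y Z
    attach (yes y∈) _ c = y , Z , l ∷⟨ (y∉C , inj₁ y∈) , t′ ⟩ c , λ s → s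
    attach (no y∉) (inj₁ y∈) c = contradiction y∈ y∉
    attach (no y∉) (inj₂ r) c with m<1+n⇒m<n∨m≡n r
    ... | inj₁ r′   = y , Z , l ∷⟨ (y∉C , inj₂ r′) , t′ ⟩ c , λ s → s
    -- Here the rank of `y` is exactly `m`, the largest still allowed outside an(T), as `merge`
    -- requires.
    ... | inj₂ refl = w , Z ∪ Z′ , join c , tip-union t′
      where
      join : Chain (Stage m) y w Z′ → Chain (Stage m) x w (Z ∪ Z′)
      join c = relink c (merge y∉ lx (next c) t′ l (first c)) (tip-unionʳ t′)
        where
        first : ∀ {w Z′} → Chain (Stage m) y w Z′ → Link y w Z′
        first (last l)        = l
        first (l ∷⟨ _ , _ ⟩ _) = l
        next : ∀ {w Z′} → Chain (Stage m) y w Z′ → Low (suc m) w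
        next (last _) = inj₁ (InAn-self G₂ (∈-triple₂ a C))
        next (_ ∷⟨ (_ , inj₁ i) , _ ⟩ _) = inj₁ i
        next (_ ∷⟨ (_ , inj₂ r) , _ ⟩ _) = inj₂ (m≤n⇒m≤1+n r)

  lower-all : ∀ m {w Z} → Chain (Stage m) a w Z → ∃ λ w′ → ∃ λ Z′ → Chain (Stage 0) a w′ Z′
  lower-all zero    c = _ , _ , c
  lower-all (suc m) c =
    let _ , _ , c′ , _ = lower (inj₁ (InAn-self G₂ (∈-triple₁ C))) c
    in lower-all m c′

  module _ (no-walk : ∀ s → ValidSteps G₂ a s → lastV G₂ a s ≡ b → ¬ MConnOK G₂ C s) where
    open ColliderWalks G₂ C a b no-walk using (OpenIf; AnyKind; along-district-set)

    step : ∀ {x y Z} → Link x y Z → x ∉ C → InAn G₂ T x → InAn G₂ T y →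
           OpenIf AnyKind y → OpenIf AnyKind x
    step {x} {y} {Z} (Z⊆C , X∈S) x∉C x∈ y∈ =
      along-district-set (proj₁ same X∈S) (∈-triple₁ Z) (∈-triple₂ x Z)
        (triple-elim (InAn G₂ T) x∈ y∈ (λ i → InAn-self G₂ (∈-triple₃ (Z⊆C i)))) x∉C

    chain-walk : ∀ {x w Z} → x ∉ C → InAn G₂ T x → Chain (Stage 0) x w Z → OpenIf AnyKind x
    chain-walk x∉C x∈ (last l) = step l x∉C x∈ b∈ ([] , tt , refl , λ _ _ → tt)
      where b∈ = InAn-self G₂ (∈-triple₂ a C)
    chain-walk x∉C x∈ (l ∷⟨ (y∉C , inj₁ y∈) , _ ⟩ c) = step l x∉C x∈ y∈ (chain-walk y∉C y∈ c)

-- From S(G) to m-connection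

InS-connected : ∀ {n} (G : ADMG n) {C X a b} → InS′ G X → a ∈ X → b ∈ X → a ∉ C →
                (∀ {v} → v ∈ X → v ∈ triple a b C) → ¬ ¬ MConnecting G C a b
InS-connected G {C} {X} {a} {b} X∈S a∈ b∈ a∉C X⊆ none =
  -- The walk is extended backwards from the trivial one at `b`. The double negation arises because
  -- `ColliderWalks` assumes that there is no open walk.
  let s , v , l , ok = along-district-set X∈S a∈ b∈ (InAn-self G ∘ X⊆) a∉C ([] , tt , refl , λ _ _ → tt)
  in no-walk s v l (interior⇒mconn G C s (ok fwd tt))
  where
  no-walk : ∀ s → ValidSteps G a s → lastV G a s ≡ b → ¬ MConnOK G C s
  no-walk s v l ok = none (walk⇒path G C s v l ok)
  open ColliderWalks G C a b no-walk

SameS⇒connected : ∀ {n} (G₁ G₂ : ADMG n) → SameInS′ G₁ G₂ →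
                  ∀ {C a b} → ¬ a ≡ b → a ∉ C → MConnecting G₁ C a b → ¬ ¬ MConnecting G₂ C a b
SameS⇒connected G₁ G₂ same a≢b a∉C ([] , _ , _ , a≡b , _) none = a≢b a≡b
SameS⇒connected {n} G₁ G₂ same {C} {a} {b} a≢b a∉C ((k , y) ∷ s , (e , v) , _ , l , ok) none =
  -- Every rank is at most `n`, so the bound `suc n` puts no restriction on the chain vertices
  -- outside C.
  let _ , _ , c , _ = toChain (Stage (suc n)) (λ y∉ → y∉ , inj₂ (s≤s (rank≤n G₂ _))) k a y s e v l ok
      _ , _ , c′    = lower-all (suc n) c
      s′ , v′ , l′ , ok′ = chain-walk no-walk a∉C (InAn-self G₂ (∈-triple₁ C)) c′
  in no-walk s′ v′ l′ (interior⇒mconn G₂ C s′ (ok′ fwd tt))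
  where
  open Chains G₁ C b
  open Transfer G₁ G₂ same C a b
  no-walk : ∀ s → ValidSteps G₂ a s → lastV G₂ a s ≡ b → ¬ MConnOK G₂ C s
  no-walk s v l ok = none (walk⇒path G₂ C s v l ok)

-- From m-connection to S(G)

-- Conversely, a path from a barren h ∈ X to v ∈ X that is m-connecting given
-- an(X) \ {h , v} is a collider path in an(X).
module _ {n : ℕ} (G : ADMG n) (X : Subset n) {h v : Fin n}
  (h∈ : h ∈ X) (barren : Barren G X h) (v∈ : v ∈ X) where

  Rest? : ∀ u → Dec (InAn G X u × ¬ u ≡ h × ¬ u ≡ v)
  Rest? u = inAn? G X u ×-dec (¬? (u ≟ h) ×-dec ¬? (u ≟ v))

  rest : Subset n
  rest = comprehension Rest?

  rest⁻ : ∀ {u} → u ∈ rest → InAn G X u × ¬ u ≡ h × ¬ u ≡ v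
  rest⁻ = ∈-comprehension⁻ Rest?

  X⊆rest : ∀ {u} → u ∈ X → u ∈ triple h v rest
  X⊆rest {u} i with u ≟ h | u ≟ v
  ... | yes refl | _        = ∈-triple₁ rest
  ... | no _     | yes refl = ∈-triple₂ h rest
  ... | no u≢h   | no u≢v   = ∈-triple₃ (∈-comprehension⁺ Rest? (InAn-self G i , u≢h , u≢v))

  reached : ∀ k y s → headAtEnd G k ≡ true → ValidSteps G y s → lastV G y s ≡ v →
            InteriorOK G rest k y s → InAn G X y
  reached k y s head val l ok
    with open-descends G rest k y s head val ok (lastV∈vertices G rest y s)
  ... | inj₁ i = InAn-mono G (proj₁ ∘ rest⁻) i
  ... | inj₂ p = v , v∈ , subst (IsAnc G y) l p

  -- Each vertex met is in an(X), hence in `rest` unless it is `h` or `v`. A noncollider before `v`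
  -- would thus be blocked, or be `h` with a child in an(X), against barrenness.
  collider-path : ∀ {x} k y s → Star (BidIn G X) h x → InAn G X x → Edge G k x y → ¬ k ≡ fwd →
                  ValidSteps G y s → lastV G y s ≡ v → InteriorOK G rest k y s → Hangs G X h v
  collider-path fwd y s p x∈ e k≢ val l ok = contradiction refl k≢
  collider-path {x} bwd y s p x∈ e k≢ val l ok with y ≟ v
  ... | yes refl = x , p , inj₂ e
  collider-path bwd y [] p x∈ e k≢ val l ok | no y≢v = contradiction l y≢v
  collider-path bwd y (_ ∷ _) p x∈ e k≢ val l (y∉ , _) | no y≢v with y ≟ h
  ... | yes refl = contradiction x∈ (barren e)
  ... | no y≢h   = contradiction (∈-comprehension⁺ Rest? (InAn-step G (e ◅ ε) x∈ , y≢h , y≢v)) y∉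
  collider-path {x} bi y s p x∈ e k≢ val l ok = extend s val l ok
    where
    y∈ : InAn G X y
    y∈ = reached bi y s refl val l ok
    q : Star (BidIn G X) h y
    q = p ◅◅ (e , x∈ , y∈) ◅ ε
    extend : ∀ s → ValidSteps G y s → lastV G y s ≡ v → InteriorOK G rest bi y s → Hangs G X h v
    extend [] val l ok = y , q , inj₁ (sym l)
    extend ((k′ , z) ∷ s) (e′ , val) l (j , ok) with y ≟ v
    ... | yes refl = v , q , inj₁ refl
    ... | no y≢v with k′
    ...   | bwd = collider-path bwd z s q y∈ e′ (λ ()) val l ok
    ...   | bi  = collider-path bi  z s q y∈ e′ (λ ()) val l ok
    ...   | fwd with y ≟ h
    ...     | yes refl = contradiction (reached fwd z s refl val l ok) (barren e′)
    ...     | no y≢h   = contradiction (∈-comprehension⁺ Rest? (y∈ , y≢h , y≢v)) j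

  connected⇒hangs : MConnecting G rest h v → Hangs G X h v
  connected⇒hangs ([] , _ , _ , refl , _) = h , ε , inj₁ refl
  connected⇒hangs ((fwd , y) ∷ s , (e , val) , _ , l , ok) =
    contradiction (reached fwd y s refl val l ok) (barren e)
  connected⇒hangs ((bwd , y) ∷ s , (e , val) , _ , l , ok) =
    collider-path bwd y s ε (InAn-self G h∈) e (λ ()) val l ok
  connected⇒hangs ((bi , y) ∷ s , (e , val) , _ , l , ok) =
    collider-path bi y s ε (InAn-self G h∈) e (λ ()) val l ok

-- Root X at a vertex `h` barren in `G₂`. If some `v` did not hang from it, `h` and `v` would be
-- m-separated by `rest` in `G₂`, hence in `G₁`, although X is in S(G₁) and X ⊆ {h , v} ∪ rest.
Markov⇒InS : ∀ {n} (G₁ G₂ : ADMG n) → MarkovEquivalent G₁ G₂ → ∀ {X} → InS′ G₁ X → InS′ G₂ X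
Markov⇒InS G₁ G₂ equiv {X} X∈S@(_ , (_ , x∈ , _) , _) =
  h , InAn-self G₂ h∈ , λ {v} v∈ → decidable-stable (hangs? G₂ X h v) (stable v∈)
  where
  top = barren-above G₂ x∈
  h = proj₁ top
  h∈ : h ∈ X
  h∈ = proj₁ (proj₂ top)
  barren : Barren G₂ X h
  barren = proj₁ (proj₂ (proj₂ top))
  stable : ∀ {v} → v ∈ X → ¬ ¬ Hangs G₂ X h v
  stable {v} v∈ ¬hangs with h ≟ v
  ... | yes refl = ¬hangs (h , ε , inj₁ refl)
  ... | no h≢v =
    InS-connected G₁ X∈S h∈ v∈ h∉ (X⊆rest G₂ X h∈ barren v∈)
      (Equivalence.from (equiv ⁅ h ⁆ ⁅ v ⁆ C disj (off h∉) (off v∉) (h , x∈⁅x⁆ h) (v , x∈⁅x⁆ v))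
        sep₂ h v (x∈⁅x⁆ h) (x∈⁅x⁆ v))
    where
    C = rest G₂ X h∈ barren v∈
    h∉ : h ∉ C
    h∉ i = proj₁ (proj₂ (rest⁻ G₂ X h∈ barren v∈ i)) refl
    v∉ : v ∉ C
    v∉ i = proj₂ (proj₂ (rest⁻ G₂ X h∈ barren v∈ i)) refl
    disj : Disjoint ⁅ h ⁆ ⁅ v ⁆
    disj x i j = h≢v (trans (sym (x∈⁅y⁆⇒x≡y h i)) (x∈⁅y⁆⇒x≡y v j))
    off : ∀ {u} → u ∉ C → Disjoint ⁅ u ⁆ C
    off {u} u∉ x i j = u∉ (subst (_∈ C) (x∈⁅y⁆⇒x≡y u i) j)
    sep₂ : MSeparated G₂ ⁅ h ⁆ ⁅ v ⁆ C
    sep₂ x y i j m with x∈⁅y⁆⇒x≡y h i | x∈⁅y⁆⇒x≡y v j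
    ... | refl | refl = ¬hangs (connected⇒hangs G₂ X h∈ barren v∈ m)

-- Both directions of the equivalence

Markov-sym : ∀ {n} {G₁ G₂ : ADMG n} → MarkovEquivalent G₁ G₂ → MarkovEquivalent G₂ G₁
Markov-sym equiv A B C ab ac bc a b =
  let e = equiv A B C ab ac bc a b in mk⇔ (Equivalence.from e) (Equivalence.to e)

theorem3p8 : {n : ℕ} (G₁ G₂ : ADMG n) → (MarkovEquivalent G₁ G₂ ⇔ SameS G₁ G₂)
theorem3p8 G₁ G₂ = mk⇔ markov⇒same same⇒markov
  where
  markov⇒same : MarkovEquivalent G₁ G₂ → SameS G₁ G₂
  markov⇒same equiv X = mk⇔
    (InS′⇒InS G₂ ∘ Markov⇒InS G₁ G₂ equiv ∘ InS⇒InS′ G₁)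
    (InS′⇒InS G₁ ∘ Markov⇒InS G₂ G₁ (Markov-sym {G₁ = G₁} {G₂} equiv) ∘ InS⇒InS′ G₂)
  same⇒markov : SameS G₁ G₂ → MarkovEquivalent G₁ G₂
  same⇒markov same A B C ab ac bc _ _ = mk⇔
    (λ sep a b i j m → SameS⇒connected G₂ G₁ (from′ , to′) (distinct i j) (ac a i) m (sep a b i j))
    (λ sep a b i j m → SameS⇒connected G₁ G₂ (to′ , from′) (distinct i j) (ac a i) m (sep a b i j))
    where
    distinct : ∀ {a b} → a ∈ A → b ∈ B → ¬ a ≡ b
    distinct i j refl = ab _ i j
    to′ : ∀ {X} → InS′ G₁ X → InS′ G₂ X
    to′ = InS⇒InS′ G₂ ∘ Equivalence.to (same _) ∘ InS′⇒InS G₁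
    from′ : ∀ {X} → InS′ G₂ X → InS′ G₁ X
    from′ = InS⇒InS′ G₁ ∘ Equivalence.from (same _) ∘ InS′⇒InS G₂
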